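{- In every $4$-total coloring of a cubic graph of order $16$, the color class configuration is $(10,10,10,10)$ or $(11,10,10,9)$. Both configurations are attained by $4$-total colorings of the connected cubic graph $H_{16}$; in particular, $(11,10,10,9)$ is the unique configuration of a non-equitable $4$-total coloring of a cubic graph of order $16$.
   Context: All graphs are finite, simple and cubic ($3$-regular), not necessarily connected unless stated. The order of a graph is its number of vertices. A $4$-total coloring of $G$ assigns one of the four colors $1,2,3,4$ to each vertex and each edge of $G$ so that adjacent vertices receive distinct colors, adjacent edges (edges sharing an endpoint) receive distinct colors, and every vertex and edge that are incident receive distinct colors. The color class $c_i$ is the set of all vertices and edges of color $i$. The color class configuration of the coloring is the multiset $\{|c_1|,|c_2|,|c_3|,|c_4|\}$, written as a non-increasing sequence. The coloring is equitable if $\bigl||c_i|-|c_j|\bigr| \le 1$ for all $i,j \in \{1,2,3,4\}$, and non-equitable otherwise. The graph $H_{16}$ has vertex set $\{0,1,\ldots,15\}$ and edge set $\{(0,2), (0,8), (0,15), (1,7), (1,9), (1,12), (2,4), (2,13), (3,5), (3,7), (3,15), (4,10), (4,14), (5,8), (5,11), (6,7), (6,12), (6,13), (8,15), (9,11), (9,13), (10,12), (10,14), (11,14)\}$, where $(a,b)$ denotes the undirected edge joining $a$ and $b$. -}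

module Defs where

open import Data.Bool.Base using (Bool; false; T; _∨_)
open import Data.Bool.Properties using (∨-comm) renaming (_≟_ to _≟ᵇ_)
open import Data.Fin.Base using (Fin; toℕ; _<_)
open import Data.Fin.Properties using (_≟_; _<?_; all?)
open import Data.List.Base
  using (List; []; _∷_; _++_; map; mapMaybe; filter; length; allFin; cartesianProduct)
open import Data.List.Membership.DecPropositional using (_∈?_)
open import Data.List.Relation.Binary.Permutation.Propositional using (_↭_)
open import Data.Maybe.Base as Maybe using (Maybe)
open import Data.Nat.Base as ℕ using (ℕ; ∣_-_∣)
import Data.Nat.Properties as ℕ
open import Data.Product.Base using (_×_; _,_)
open import Data.Product.Properties using (≡-dec)
open import Data.Sum.Base using (_⊎_; inj₁; inj₂)
open import Relation.Binary.Construct.Closure.ReflexiveTransitive using (Star)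
open import Relation.Binary.PropositionalEquality using (_≡_; _≢_)
open import Relation.Nullary.Decidable using (⌊_⌋; _×-dec_; T?; dec⇒maybe; from-yes)

-- A finite simple graph of order n, on the vertex set Fin n.
record Graph (n : ℕ) : Set where
  field
    adj    : Fin n → Fin n → Bool
    sym    : ∀ u v → adj u v ≡ adj v u
    irrefl : ∀ v → adj v v ≡ false

  Adj : Fin n → Fin n → Set
  Adj u v = T (adj u v)

module _ {n : ℕ} (G : Graph n) where
  open Graph G

  degree : Fin n → ℕ
  degree v = length (filter (λ u → T? (adj v u)) (allFin n))

  Cubic : Set
  Cubic = ∀ v → degree v ≡ 3

  Connected : Set
  Connected = ∀ u v → Star Adj u v

  -- An undirected edge is represented once, by its endpoints in increasing
  -- order; T and _<_ are proof-irrelevant, so equality of edges is equality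
  -- of endpoints.
  record Edge : Set where
    constructor edge
    field
      lo hi    : Fin n
      lo<hi    : lo < hi
      adjacent : Adj lo hi

  data Incident (v : Fin n) (e : Edge) : Set where
    at-lo : v ≡ Edge.lo e → Incident v e
    at-hi : v ≡ Edge.hi e → Incident v e

  Element : Set
  Element = Fin n ⊎ Edge

  toEdge? : Fin n × Fin n → Maybe Edge
  toEdge? (u , v) =
    Maybe.map (λ { (u<v , a) → edge u v u<v a }) (dec⇒maybe (u <? v ×-dec T? (adj u v)))

  -- Every edge exactly once.
  edges : List Edge
  edges = mapMaybe toEdge? (cartesianProduct (allFin n) (allFin n))

  elements : List Element
  elements = map inj₁ (allFin n) ++ map inj₂ edges

  -- The k colors are the elements of Fin k.
  record TotalColoring (k : ℕ) : Set where
    field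
      color : Element → Fin k
      vertex-vertex : ∀ u v → Adj u v → color (inj₁ u) ≢ color (inj₁ v)
      edge-edge     : ∀ e f → e ≢ f → ∀ v → Incident v e → Incident v f →
                      color (inj₂ e) ≢ color (inj₂ f)
      vertex-edge   : ∀ v e → Incident v e → color (inj₁ v) ≢ color (inj₂ e)

module _ {n k : ℕ} {G : Graph n} (c : TotalColoring G k) where
  open TotalColoring c

  colorClass : Fin k → List (Element G)
  colorClass i = filter (λ x → color x ≟ i) (elements G)

  classSizes : List ℕ
  classSizes = map (λ i → length (colorClass i)) (allFin k)

  -- Lists up to permutation are multisets, so the order in which the
  -- configuration is written is immaterial.
  HasConfiguration : List ℕ → Set
  HasConfiguration xs = classSizes ↭ xs

  Equitable : Set
  Equitable = ∀ i j → ∣ length (colorClass i) - length (colorClass j) ∣ ℕ.≤ 1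

H₁₆-edges : List (ℕ × ℕ)
H₁₆-edges =
  (0 , 2) ∷ (0 , 8) ∷ (0 , 15) ∷ (1 , 7) ∷ (1 , 9) ∷ (1 , 12) ∷
  (2 , 4) ∷ (2 , 13) ∷ (3 , 5) ∷ (3 , 7) ∷ (3 , 15) ∷ (4 , 10) ∷
  (4 , 14) ∷ (5 , 8) ∷ (5 , 11) ∷ (6 , 7) ∷ (6 , 12) ∷ (6 , 13) ∷
  (8 , 15) ∷ (9 , 11) ∷ (9 , 13) ∷ (10 , 12) ∷ (10 , 14) ∷ (11 , 14) ∷ []

H₁₆-listed : Fin 16 → Fin 16 → Bool
H₁₆-listed u v = ⌊ _∈?_ (≡-dec ℕ._≟_ ℕ._≟_) (toℕ u , toℕ v) H₁₆-edges ⌋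

H₁₆ : Graph 16
H₁₆ = record
  { adj    = λ u v → H₁₆-listed u v ∨ H₁₆-listed v u
  ; sym    = λ u v → ∨-comm (H₁₆-listed u v) (H₁₆-listed v u)
  ; irrefl = from-yes (all? (λ v → (H₁₆-listed v v ∨ H₁₆-listed v v) ≟ᵇ false))
  }

{-# OPTIONS --safe #-}
-- Since the vertices have degree 3 and there are 4 colors, every color i occurs
-- exactly once among each vertex and its three incident edges.  Hence, if v i
-- vertices and e i edges have color i, then v i + 2 (e i) = 16, so v i is even,
-- v i = 2 (a i) say, and the color class has size 8 + a i, where Σ a i = 8.  The
-- edges of color i match the vertices not colored i, and at most one end of each
-- is colored j, so v j ≤ e i, that is a i + 2 (a j) ≤ 8 for i ≠ j.  The only
-- solutions are (2,2,2,2) and the permutations of (3,2,2,1).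
module Submission where

open import Defs
open import Data.Bool.Base using (true; false; T; if_then_else_)
open import Data.Bool.Properties using (T-irrelevant)
open import Data.Fin using (#_)
open import Data.Fin.Base using (Fin; zero; suc; toℕ; _<_)
open import Data.Fin.Patterns using (0F; 1F; 2F; 3F)
open import Data.Fin.Properties
  using (_≟_; _<?_; all?; <-cmp; <-irrelevant; <-asym; 0≢1+n; suc-injective)
open import Data.List.Base as List
  using (List; []; _∷_; _++_; map; mapMaybe; filter; length; allFin; cartesianProduct)
open import Data.List.Properties
  using (≡-dec; map-cong; length-++; filter-++; map-tabulate)
open import Data.List.Relation.Binary.Permutation.Propositional
  using (_↭_; ↭-sym; ↭-trans; ↭-reflexive)
open import Data.List.Relation.Binary.Permutation.Propositional.Properties using (All-resp-↭)
open import Data.List.Relation.Unary.All using (All; []; _∷_)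
import Data.List.Relation.Unary.All.Properties as All
open import Data.Maybe.Base using (Maybe; just; nothing; maybe′)
open import Data.Nat.Base as ℕ using (ℕ; pred; _+_; _*_; _∸_; _≤_; z≤n; s≤s; _≡ᵇ_)
import Data.Nat.Properties as ℕ
open import Data.Nat.Solver using (module +-*-Solver)
open import Data.Product.Base using (Σ; Σ-syntax; _×_; _,_; proj₁; proj₂)
open import Data.Sum.Base as Sum using (_⊎_; inj₁; inj₂)
open import Data.Vec.Base using (Vec; []; _∷_; lookup; tabulate)
open import Data.Vec.Properties using (lookup∘tabulate)
open import Function.Base using (_∘_; id)
open import Function.Bundles using (_⇔_; mk⇔)
open import Relation.Binary.Construct.Closure.ReflexiveTransitive
  using (Star; ε; _◅_; _◅◅_; reverse)
open import Relation.Binary.Definitions using (tri<; tri≈; tri>)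
open import Relation.Binary.PropositionalEquality
open import Relation.Nullary.Decidable
  using (Dec; yes; no; does; decidable-stable; T?; ¬?; _×-dec_; _⊎-dec_; _→-dec_; from-yes)
open import Relation.Nullary.Negation.Core using (¬_; contradiction)
open import Relation.Unary using (Decidable)
open import Algebra.Properties.Semiring.Sum ℕ.+-*-semiring
open import Data.List.Sort.Base ℕ.≤-totalOrder using (module SortingAlgorithm)
open import Data.List.Sort.InsertionSort ℕ.≤-decTotalOrder using (insertionSort)
open SortingAlgorithm insertionSort using (sort; sort-↭)
open +-*-Solver using (solve; _:+_; _:=_)

-- Indicators and sums over finite sets.

𝟙 : {P : Set} → Dec P → ℕ
𝟙 P? = if does P? then 1 else 0

𝟙-yes : {P : Set} (P? : Dec P) → P → 𝟙 P? ≡ 1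
𝟙-yes (yes _) p = refl
𝟙-yes (no ¬p) p = contradiction p ¬p

𝟙-no : {P : Set} (P? : Dec P) → ¬ P → 𝟙 P? ≡ 0
𝟙-no (yes p) ¬p = contradiction p ¬p
𝟙-no (no _)  ¬p = refl

𝟙≤1 : {P : Set} (P? : Dec P) → 𝟙 P? ≤ 1
𝟙≤1 (yes _) = s≤s z≤n
𝟙≤1 (no _)  = z≤n

∑-mono-≤ : ∀ {n} {f g : Fin n → ℕ} → (∀ i → f i ≤ g i) → sum f ≤ sum g
∑-mono-≤ {ℕ.zero}  f≤g = z≤n
∑-mono-≤ {ℕ.suc n} f≤g = ℕ.+-mono-≤ (f≤g zero) (∑-mono-≤ (f≤g ∘ suc))

∑-const : ∀ n m → ∑[ i < n ] m ≡ n * m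
∑-const ℕ.zero    m = refl
∑-const (ℕ.suc n) m = cong (m +_) (∑-const n m)

∑-zero : ∀ {n} {f : Fin n → ℕ} → (∀ i → f i ≡ 0) → sum f ≡ 0
∑-zero {n} f≡0 = trans (sum-cong-≗ f≡0) (sum-replicate-zero n)

∑-𝟙≟ : ∀ {n} (i : Fin n) → ∑[ j < n ] 𝟙 (i ≟ j) ≡ 1
∑-𝟙≟ {ℕ.suc n} zero    = cong ℕ.suc (∑-zero {n} {λ j → 𝟙 (zero ≟ suc j)} λ _ → refl)
∑-𝟙≟ (suc i) = ∑-𝟙≟ i

-- By uniqueness the first nonzero entry makes all later ones vanish, so the sum is that entry
-- alone.
∑-≤1 : ∀ {n} (f : Fin n → ℕ) → (∀ i → f i ≤ 1) →
       (∀ i j → f i ≢ 0 → f j ≢ 0 → i ≡ j) → sum f ≤ 1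
∑-≤1 {ℕ.zero}  f f≤1 unique = z≤n
∑-≤1 {ℕ.suc n} f f≤1 unique with f zero in eq
... | 0 = ∑-≤1 (f ∘ suc) (f≤1 ∘ suc) λ i j p q → suc-injective (unique (suc i) (suc j) p q)
... | ℕ.suc m = begin
  ℕ.suc m + sum (f ∘ suc)  ≡⟨ cong (ℕ.suc m +_) (∑-zero rest) ⟩
  ℕ.suc m + 0              ≡⟨ ℕ.+-identityʳ _ ⟩
  ℕ.suc m                  ≡⟨ eq ⟨
  f zero                   ≤⟨ f≤1 zero ⟩
  1                        ∎
  where
  open ℕ.≤-Reasoning
  rest : ∀ i → f (suc i) ≡ 0
  rest i with f (suc i) in eq′
  ... | 0       = refl
  ... | ℕ.suc _ = contradiction
    (unique zero (suc i) (λ p → ℕ.0≢1+n (trans (sym p) eq)) (λ p → ℕ.0≢1+n (trans (sym p) eq′)))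
    0≢1+n

-- Pigeonhole: the bound leaves no slack, since a single zero entry would keep the sum below `n`.
∑≡n⇒≡1 : ∀ {n} (f : Fin n → ℕ) → (∀ i → f i ≤ 1) → sum f ≡ n → ∀ i → f i ≡ 1
∑≡n⇒≡1 {ℕ.suc n} f f≤1 ∑≡ i with f zero in eq | f≤1 zero
... | 0 | z≤n = contradiction rest≤ (ℕ.<⇒≱ (ℕ.≤-reflexive (sym ∑≡)))
  where
  rest≤ : sum (f ∘ suc) ≤ n
  rest≤ = ℕ.≤-trans (∑-mono-≤ (f≤1 ∘ suc)) (ℕ.≤-reflexive (trans (∑-const n 1) (ℕ.*-identityʳ n)))
... | 1 | s≤s z≤n with i
...   | zero  = eq
...   | suc j = ∑≡n⇒≡1 (f ∘ suc) (f≤1 ∘ suc) (cong pred ∑≡) j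

-- Counting filtered lists by sums.

module _ {A : Set} {P : A → Set} (P? : Decidable P) where

  length-filter-tabulate : ∀ {n} (f : Fin n → A) →
    length (filter P? (List.tabulate f)) ≡ ∑[ i < n ] 𝟙 (P? (f i))
  length-filter-tabulate {ℕ.zero}  f = refl
  length-filter-tabulate {ℕ.suc n} f with does (P? (f zero))
  ... | true  = cong ℕ.suc (length-filter-tabulate (f ∘ suc))
  ... | false = length-filter-tabulate (f ∘ suc)

  length-filter-++ : ∀ xs ys →
    length (filter P? (xs ++ ys)) ≡ length (filter P? xs) + length (filter P? ys)
  length-filter-++ xs ys =
    trans (cong length (filter-++ P? xs ys)) (length-++ (filter P? xs))

  length-filter-mapMaybe-++ : ∀ {B C : Set} (h : B → A) (g : C → Maybe B) xs ys →
    length (filter P? (map h (mapMaybe g (xs ++ ys)))) ≡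
    length (filter P? (map h (mapMaybe g xs))) + length (filter P? (map h (mapMaybe g ys)))
  length-filter-mapMaybe-++ h g [] ys = refl
  length-filter-mapMaybe-++ h g (x ∷ xs) ys with g x
  ... | nothing = length-filter-mapMaybe-++ h g xs ys
  ... | just b with does (P? (h b))
  ...   | true  = cong ℕ.suc (length-filter-mapMaybe-++ h g xs ys)
  ...   | false = length-filter-mapMaybe-++ h g xs ys

  length-filter-mapMaybe-tabulate : ∀ {B C : Set} (h : B → A) (g : C → Maybe B) {n} (f : Fin n → C) →
    length (filter P? (map h (mapMaybe g (List.tabulate f)))) ≡
    ∑[ i < n ] maybe′ (λ b → 𝟙 (P? (h b))) 0 (g (f i))
  length-filter-mapMaybe-tabulate h g {ℕ.zero}  f = refl
  length-filter-mapMaybe-tabulate h g {ℕ.suc n} f with g (f zero)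
  ... | nothing = length-filter-mapMaybe-tabulate h g (f ∘ suc)
  ... | just b with does (P? (h b))
  ...   | true  = cong ℕ.suc (length-filter-mapMaybe-tabulate h g (f ∘ suc))
  ...   | false = length-filter-mapMaybe-tabulate h g (f ∘ suc)

  -- This is the shape of `edges G`: the count of the edges of a color becomes a double sum over
  -- pairs of vertices, where a pair rejected by `g` contributes 0.
  length-filter-mapMaybe-cartesianProduct :
    ∀ {B C D : Set} (h : B → A) (g : C × D → Maybe B) {m n} (f : Fin m → C) (f′ : Fin n → D) →
    length (filter P? (map h (mapMaybe g (cartesianProduct (List.tabulate f) (List.tabulate f′))))) ≡
    ∑[ i < m ] ∑[ j < n ] maybe′ (λ b → 𝟙 (P? (h b))) 0 (g (f i , f′ j))
  length-filter-mapMaybe-cartesianProduct h g {ℕ.zero}  f f′ = refl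
  length-filter-mapMaybe-cartesianProduct h g {ℕ.suc m} f f′ = begin
    count (map (f zero ,_) ys ++ zs)        ≡⟨ length-filter-mapMaybe-++ h g (map (f zero ,_) ys) zs ⟩
    count (map (f zero ,_) ys) + count zs   ≡⟨ cong (λ l → count l + count zs) (map-tabulate f′ (f zero ,_)) ⟩
    count (List.tabulate λ j → f zero , f′ j) + count zs
      ≡⟨ cong₂ _+_ (length-filter-mapMaybe-tabulate h g (λ j → f zero , f′ j))
                   (length-filter-mapMaybe-cartesianProduct h g (f ∘ suc) f′) ⟩
    _ ∎
    where
    open ≡-Reasoning
    ys = List.tabulate f′
    zs = cartesianProduct (List.tabulate (f ∘ suc)) ys
    count = λ xs → length (filter P? (map h (mapMaybe g xs)))

-- Edges seen from their ends.

module _ {n : ℕ} (G : Graph n) where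
  open Graph G using (adj; Adj)

  Adj-sym : ∀ {u v} → Adj u v → Adj v u
  Adj-sym {u} {v} = subst T (Graph.sym G u v)

  ¬Adj-refl : ∀ {v} → ¬ Adj v v
  ¬Adj-refl {v} = subst T (Graph.irrefl G v)

  degree-∑ : ∀ v → degree G v ≡ ∑[ u < n ] 𝟙 (T? (adj v u))
  degree-∑ v = length-filter-tabulate (λ u → T? (adj v u)) id

  toEdge?-just : ∀ {u v} (p : u < v) (a : Adj u v) → toEdge? G (u , v) ≡ just (edge u v p a)
  toEdge?-just {u} {v} p a with u <? v ×-dec T? (adj u v)
  ... | yes (p′ , a′) = cong just (cong₂ (edge u v) (<-irrelevant p′ p) (T-irrelevant a′ a))
  ... | no ¬pa        = contradiction (p , a) ¬pa

  toEdge?-nothing : ∀ {u v} → ¬ (u < v × Adj u v) → toEdge? G (u , v) ≡ nothing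
  toEdge?-nothing {u} {v} ¬pa with u <? v ×-dec T? (adj u v)
  ... | yes pa = contradiction pa ¬pa
  ... | no _   = refl

  -- An edge stores its ends in increasing order, whereas counting at a vertex needs both
  -- orientations.
  data Joins (e : Edge G) (u v : Fin n) : Set where
    up   : u ≡ Edge.lo e → v ≡ Edge.hi e → Joins e u v
    down : u ≡ Edge.hi e → v ≡ Edge.lo e → Joins e u v

  Joins-incidentˡ : ∀ {e u v} → Joins e u v → Incident G u e
  Joins-incidentˡ (up p _)   = at-lo p
  Joins-incidentˡ (down p _) = at-hi p

  -- If the two orientations were mixed, `lo` and `hi` would coincide.
  Joins-functional : ∀ {e u v w} → Joins e u v → Joins e u w → v ≡ w
  Joins-functional (up _ p)     (up _ q)     = trans p (sym q)
  Joins-functional (down _ p)   (down _ q)   = trans p (sym q)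
  Joins-functional {edge _ _ p _} (up refl _) (down refl _) = contradiction p (ℕ.<-irrefl refl)
  Joins-functional {edge _ _ p _} (down refl _) (up refl _) = contradiction p (ℕ.<-irrefl refl)

  -- With equal orientations only the irrelevant proof fields are left to compare; opposite ones
  -- would require both `u < v` and `v < u`.
  Joins-injective : ∀ {e f u v} → Joins e u v → Joins f u v → e ≡ f
  Joins-injective {edge lo hi p a} {edge _ _ p′ a′} (up refl refl) (up refl refl) =
    cong₂ (edge lo hi) (<-irrelevant p p′) (T-irrelevant a a′)
  Joins-injective {edge lo hi p a} {edge _ _ p′ a′} (down refl refl) (down refl refl) =
    cong₂ (edge lo hi) (<-irrelevant p p′) (T-irrelevant a a′)
  Joins-injective {edge _ _ p _} {edge _ _ p′ _} (up refl refl) (down refl refl) =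
    contradiction p′ (<-asym p)
  Joins-injective {edge _ _ p _} {edge _ _ p′ _} (down refl refl) (up refl refl) =
    contradiction p′ (<-asym p)

  Joins-Adj : ∀ {e u v} → Joins e u v → Adj u v
  Joins-Adj {e} (up refl refl)   = Edge.adjacent e
  Joins-Adj {e} (down refl refl) = Adj-sym (Edge.adjacent e)

  edge-between : ∀ {u v} → Adj u v → Σ[ e ∈ Edge G ] Joins e u v
  edge-between {u} {v} a with <-cmp u v
  ... | tri< p _ _    = edge u v p a , up refl refl
  ... | tri≈ _ refl _ = contradiction a ¬Adj-refl
  ... | tri> _ _ p    = edge v u p (Adj-sym a) , down refl refl

  edge-or-¬Adj : ∀ u v → (Σ[ e ∈ Edge G ] Joins e u v) ⊎ ¬ Adj u v
  edge-or-¬Adj u v with T? (adj u v)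
  ... | yes a = inj₁ (edge-between a)
  ... | no ¬a = inj₂ ¬a

  -- Counting a color around each vertex.

  module _ {k : ℕ} (c : TotalColoring G k) where
    open TotalColoring c

    color# : Fin k → Fin n → ℕ
    color# i v = 𝟙 (color (inj₁ v) ≟ i)

    vertices# : Fin k → ℕ
    vertices# i = ∑[ v < n ] color# i v

    -- Since `toEdge?` accepts increasing pairs only, an edge contributes to just one of its two
    -- ordered pairs.
    orientedColor# : Fin k → Fin n → Fin n → ℕ
    orientedColor# i u v = maybe′ (λ e → 𝟙 (color (inj₂ e) ≟ i)) 0 (toEdge? G (u , v))

    -- The (u , v) entry of the adjacency matrix of the graph of edges of color i.
    link : Fin k → Fin n → Fin n → ℕ
    link i u v = orientedColor# i u v + orientedColor# i v u

    edges# : Fin k → ℕ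
    edges# i = ∑[ u < n ] ∑[ v < n ] orientedColor# i u v

    length-colorClass : ∀ i → length (colorClass c i) ≡ vertices# i + edges# i
    length-colorClass i = begin
      length (colorClass c i)
        ≡⟨ length-filter-++ P? (map inj₁ (allFin n)) (map inj₂ (edges G)) ⟩
      length (filter P? (map inj₁ (allFin n))) + length (filter P? (map inj₂ (edges G)))
        ≡⟨ cong₂ _+_
             (trans (cong (length ∘ filter P?) (map-tabulate id inj₁)) (length-filter-tabulate P? inj₁))
             (length-filter-mapMaybe-cartesianProduct P? inj₂ (toEdge? G) id id) ⟩
      vertices# i + edges# i ∎
      where
      open ≡-Reasoning
      P? = λ x → color x ≟ i

    link-sym : ∀ i u v → link i u v ≡ link i v u
    link-sym i u v = ℕ.+-comm (orientedColor# i u v) _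

    link-Joins : ∀ {u v e} → Joins e u v → ∀ i → link i u v ≡ 𝟙 (color (inj₂ e) ≟ i)
    link-Joins {e = e@(edge _ _ p a)} (up refl refl) i
      rewrite toEdge?-just p a | toEdge?-nothing (λ (q , _) → <-asym p q) = ℕ.+-identityʳ _
    link-Joins {e = e@(edge _ _ p a)} (down refl refl) i
      rewrite toEdge?-just p a | toEdge?-nothing (λ (q , _) → <-asym p q) = refl

    link-¬Adj : ∀ {u v} → ¬ Adj u v → ∀ i → link i u v ≡ 0
    link-¬Adj ¬a i
      rewrite toEdge?-nothing (λ (_ , a) → ¬a a) | toEdge?-nothing (λ (_ , a) → ¬a (Adj-sym a)) = refl

    link≢0 : ∀ i u v → link i u v ≢ 0 → Σ[ e ∈ Edge G ] Joins e u v × color (inj₂ e) ≡ i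
    link≢0 i u v l≢0 with edge-or-¬Adj u v
    ... | inj₂ ¬a      = contradiction (link-¬Adj ¬a i) l≢0
    ... | inj₁ (e , j) with color (inj₂ e) ≟ i
    ...   | yes eq = e , j , eq
    ...   | no ¬eq = contradiction (trans (link-Joins j i) (𝟙-no (color (inj₂ e) ≟ i) ¬eq)) l≢0

    link≤1 : ∀ i u v → link i u v ≤ 1
    link≤1 i u v with edge-or-¬Adj u v
    ... | inj₂ ¬a      = ℕ.≤-trans (ℕ.≤-reflexive (link-¬Adj ¬a i)) z≤n
    ... | inj₁ (e , j) = ℕ.≤-trans (ℕ.≤-reflexive (link-Joins j i)) (𝟙≤1 (color (inj₂ e) ≟ i))

    -- An edge carries exactly one color, so the matrices of the separate colors add up to the
    -- adjacency matrix.
    ∑-link-color : ∀ u v → ∑[ i < k ] link i u v ≡ 𝟙 (T? (adj u v))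
    ∑-link-color u v with edge-or-¬Adj u v
    ... | inj₂ ¬a      = trans (∑-zero (link-¬Adj ¬a)) (sym (𝟙-no (T? (adj u v)) ¬a))
    ... | inj₁ (e , j) = begin
      ∑[ i < k ] link i u v                  ≡⟨ sum-cong-≗ (link-Joins j) ⟩
      ∑[ i < k ] 𝟙 (color (inj₂ e) ≟ i)      ≡⟨ ∑-𝟙≟ (color (inj₂ e)) ⟩
      1                                      ≡⟨ 𝟙-yes (T? (adj u v)) (Joins-Adj j) ⟨
      𝟙 (T? (adj u v))                       ∎
      where open ≡-Reasoning

    link≢0⇒color≢ : ∀ {i u v} → link i u v ≢ 0 → color (inj₁ u) ≢ i
    link≢0⇒color≢ {i} {u} {v} l≢0 with link≢0 i u v l≢0
    ... | e , j , refl = vertex-edge u e (Joins-incidentˡ j)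

    link≢0⇒Adj : ∀ {i u v} → link i u v ≢ 0 → Adj u v
    link≢0⇒Adj {i} {u} {v} l≢0 with link≢0 i u v l≢0
    ... | _ , j , _ = Joins-Adj j

    link-unique : ∀ i u v w → link i u v ≢ 0 → link i u w ≢ 0 → v ≡ w
    link-unique i u v w p q with link≢0 i u v p | link≢0 i u w q
    ... | e , j , eq | f , j′ , eq′ = decidable-stable (v ≟ w) λ v≢w →
      edge-edge e f (λ { refl → v≢w (Joins-functional j j′) }) u
        (Joins-incidentˡ j) (Joins-incidentˡ j′) (trans eq (sym eq′))

    -- If `u` has color `i`, no incident edge may have it; otherwise properness at `u` leaves room
    -- for one incident edge of color `i`.
    incidence≤1 : ∀ u i → color# i u + ∑[ v < n ] link i u v ≤ 1
    incidence≤1 u i with color (inj₁ u) ≟ i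
    ... | yes eq = ℕ.≤-reflexive (cong ℕ.suc (∑-zero λ v →
      decidable-stable (link i u v ℕ.≟ 0) λ l≢0 → link≢0⇒color≢ l≢0 eq))
    ... | no _   = ∑-≤1 (link i u) (link≤1 i u) (link-unique i u)

    -- Handshake argument: each edge of color `i` is seen once from either end.
    ∑-link : ∀ i → ∑[ u < n ] ∑[ v < n ] link i u v ≡ edges# i + edges# i
    ∑-link i = begin
      ∑[ u < n ] ∑[ v < n ] link i u v
        ≡⟨ sum-cong-≗ (λ u → ∑-distrib-+ (orientedColor# i u) (λ v → orientedColor# i v u)) ⟩
      ∑[ u < n ] (∑[ v < n ] orientedColor# i u v + ∑[ v < n ] orientedColor# i v u)
        ≡⟨ ∑-distrib-+ (λ u → ∑[ v < n ] orientedColor# i u v) _ ⟩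
      edges# i + ∑[ u < n ] ∑[ v < n ] orientedColor# i v u
        ≡⟨ cong (edges# i +_) (∑-comm (λ u v → orientedColor# i v u)) ⟩
      edges# i + edges# i ∎
      where open ≡-Reasoning

    -- Regular graphs of degree one less than the number of colors.

    module _ (regular : ∀ v → ℕ.suc (degree G v) ≡ k) where

      -- Summed over all colors, the counts at `u` give one for `u` itself plus its degree, in total
      -- `k`. None of these `k` counts exceeds 1, so pigeonhole applies.
      incidence≡1 : ∀ u i → color# i u + ∑[ v < n ] link i u v ≡ 1
      incidence≡1 u = ∑≡n⇒≡1 _ (incidence≤1 u) (begin
        ∑[ i < k ] (color# i u + ∑[ v < n ] link i u v)
          ≡⟨ ∑-distrib-+ (λ i → color# i u) _ ⟩
        ∑[ i < k ] color# i u + ∑[ i < k ] ∑[ v < n ] link i u v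
          ≡⟨ cong₂ _+_ (∑-𝟙≟ (color (inj₁ u))) (∑-comm (λ i v → link i u v)) ⟩
        1 + ∑[ v < n ] ∑[ i < k ] link i u v
          ≡⟨ cong ℕ.suc (sum-cong-≗ (∑-link-color u)) ⟩
        1 + ∑[ v < n ] 𝟙 (T? (adj u v))
          ≡⟨ cong ℕ.suc (degree-∑ u) ⟨
        ℕ.suc (degree G u)
          ≡⟨ regular u ⟩
        k ∎)
        where open ≡-Reasoning

      -- Summing `incidence≡1` over the vertices: the edges of color `i` perfectly match the
      -- vertices of the other colors.
      vertices#+2edges# : ∀ i → vertices# i + (edges# i + edges# i) ≡ n
      vertices#+2edges# i = begin
        vertices# i + (edges# i + edges# i)                  ≡⟨ cong (vertices# i +_) (∑-link i) ⟨
        vertices# i + ∑[ u < n ] ∑[ v < n ] link i u v       ≡⟨ ∑-distrib-+ (color# i) _ ⟨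
        ∑[ u < n ] (color# i u + ∑[ v < n ] link i u v)      ≡⟨ sum-cong-≗ (λ u → incidence≡1 u i) ⟩
        ∑[ u < n ] 1                                         ≡⟨ ∑-const n 1 ⟩
        n * 1                                                ≡⟨ ℕ.*-identityʳ n ⟩
        n ∎
        where open ≡-Reasoning

      ∑-vertices# : ∑[ i < k ] vertices# i ≡ n
      ∑-vertices# = begin
        ∑[ i < k ] ∑[ v < n ] color# i v   ≡⟨ ∑-comm color# ⟩
        ∑[ v < n ] ∑[ i < k ] color# i v   ≡⟨ sum-cong-≗ (λ v → ∑-𝟙≟ (color (inj₁ v))) ⟩
        ∑[ v < n ] 1                       ≡⟨ ∑-const n 1 ⟩
        n * 1                              ≡⟨ ℕ.*-identityʳ n ⟩
        n ∎
        where open ≡-Reasoning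

      -- Interaction of two distinct colors.

      module _ {i j : Fin k} (i≢j : i ≢ j) where

        vertices#-source : vertices# j ≡ ∑[ u < n ] ∑[ v < n ] (color# j u * link i u v)
        vertices#-source = sum-cong-≗ λ u → trans (saturated u) (*-distribˡ-sum (color# j u) (link i u))
          where
          -- A vertex of color `j` does not have color `i`, so by `incidence≡1` exactly one edge of
          -- color `i` leaves it.
          saturated : ∀ u → color# j u ≡ color# j u * ∑[ v < n ] link i u v
          saturated u with color (inj₁ u) ≟ j
          ... | no _     = refl
          ... | yes refl = sym (begin
            ∑[ v < n ] link i u v + 0
              ≡⟨ ℕ.+-identityʳ _ ⟩
            ∑[ v < n ] link i u v
              ≡⟨ cong (_+ ∑[ v < n ] link i u v) (𝟙-no (color (inj₁ u) ≟ i) (i≢j ∘ sym)) ⟨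
            color# i u + ∑[ v < n ] link i u v
              ≡⟨ incidence≡1 u i ⟩
            1 ∎)
            where open ≡-Reasoning

        vertices#-target : vertices# j ≡ ∑[ u < n ] ∑[ v < n ] (color# j v * link i u v)
        vertices#-target = begin
          vertices# j                                        ≡⟨ vertices#-source ⟩
          ∑[ u < n ] ∑[ v < n ] (color# j u * link i u v)    ≡⟨ ∑-comm (λ u v → color# j u * link i u v) ⟩
          ∑[ v < n ] ∑[ u < n ] (color# j u * link i u v)
            ≡⟨ sum-cong-≗ (λ v → sum-cong-≗ λ u → cong (color# j u *_) (link-sym i u v)) ⟩
          -- Up to the names of the bound variables this is the sum sought.
          ∑[ v < n ] ∑[ u < n ] (color# j u * link i v u) ∎
          where open ≡-Reasoning

        -- The ends of an edge of color `i` are adjacent, so they cannot both have color `j`; where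
        -- `link` is 0 both sides vanish.
        link-endpoints : ∀ u v → color# j u * link i u v + color# j v * link i u v ≤ link i u v
        link-endpoints u v with link i u v ℕ.≟ 0
        ... | yes l≡0 rewrite l≡0 | ℕ.*-zeroʳ (color# j u) | ℕ.*-zeroʳ (color# j v) = z≤n
        ... | no l≢0 with color (inj₁ u) ≟ j | color (inj₁ v) ≟ j
        ...   | yes p | yes q = contradiction (trans p (sym q)) (vertex-vertex u v (link≢0⇒Adj l≢0))
        ...   | yes _ | no _  = ℕ.≤-reflexive (trans (ℕ.+-identityʳ _) (ℕ.+-identityʳ _))
        ...   | no _  | yes _ = ℕ.≤-reflexive (ℕ.+-identityʳ _)
        ...   | no _  | no _  = z≤n

        vertices#-bound : vertices# i + (vertices# j + vertices# j) ≤ n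
        vertices#-bound = begin
          vertices# i + (vertices# j + vertices# j)
            -- Each vertex of color `j` is counted once as the first and once as the second end of
            -- its edge of color `i`. This matches the sum of `link` over ordered pairs, which also
            -- counts every edge twice.
            ≡⟨ cong (vertices# i +_) (cong₂ _+_ vertices#-source vertices#-target) ⟩
          vertices# i + (∑[ u < n ] ∑[ v < n ] (color# j u * link i u v)
                       + ∑[ u < n ] ∑[ v < n ] (color# j v * link i u v))
            ≡⟨ cong (vertices# i +_) (∑-distrib-+ (λ u → ∑[ v < n ] (color# j u * link i u v)) _) ⟨
          vertices# i + ∑[ u < n ] (∑[ v < n ] (color# j u * link i u v)
                                  + ∑[ v < n ] (color# j v * link i u v))
            ≡⟨ cong (vertices# i +_) (sum-cong-≗ λ u → ∑-distrib-+ (λ v → color# j u * link i u v) _) ⟨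
          vertices# i + ∑[ u < n ] ∑[ v < n ] (color# j u * link i u v + color# j v * link i u v)
            ≤⟨ ℕ.+-monoʳ-≤ (vertices# i) (∑-mono-≤ λ u → ∑-mono-≤ (link-endpoints u)) ⟩
          vertices# i + ∑[ u < n ] ∑[ v < n ] link i u v
            ≡⟨ cong (vertices# i +_) (∑-link i) ⟩
          vertices# i + (edges# i + edges# i)
            ≡⟨ vertices#+2edges# i ⟩
          n ∎
          where open ℕ.≤-Reasoning

-- Arithmetic of the class sizes for order 16.

-- Sorting gives a normal form, so the finite search can compare configurations by decidable
-- equality of lists.
sort-≡⇒↭ : ∀ xs ys → sort xs ≡ sort ys → xs ↭ ys
sort-≡⇒↭ xs ys eq = ↭-trans (↭-sym (sort-↭ xs)) (↭-trans (↭-reflexive eq) (sort-↭ ys))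

-- The targets are sorted too, because `sort` is increasing while configurations are written
-- non-increasing.
SortsToConfiguration : List ℕ → Set
SortsToConfiguration xs = sort xs ≡ sort (10 ∷ 10 ∷ 10 ∷ 10 ∷ []) ⊎ sort xs ≡ sort (11 ∷ 10 ∷ 10 ∷ 9 ∷ [])

-- With `a i` half the number of vertices of color `i`, this is twice the inequality
-- `a i + 2 (a j) ≤ 8`, in the form obtained by substituting `a + a` for the vertex counts.
Admissible : (Fin 4 → ℕ) → Set
Admissible a = ∀ i j → i ≢ j → (a i + a i) + ((a j + a j) + (a j + a j)) ≤ 16

-- Exhaustive check of the quadruples below 9. The sum condition comes first and discards most of
-- them cheaply; its trailing `+ 0` is what `sum` unfolds to.
admissible-configurations :
  ∀ {a} → a ℕ.< 9 → ∀ {b} → b ℕ.< 9 → ∀ {c} → c ℕ.< 9 → ∀ {d} → d ℕ.< 9 →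
  a + (b + (c + (d + 0))) ≡ 8 → Admissible (lookup (a ∷ b ∷ c ∷ d ∷ [])) →
  SortsToConfiguration (map (8 +_) (a ∷ b ∷ c ∷ d ∷ []))
admissible-configurations = from-yes
  (ℕ.allUpTo? (λ a → ℕ.allUpTo? (λ b → ℕ.allUpTo? (λ c → ℕ.allUpTo? (λ d →
    (a + (b + (c + (d + 0))) ℕ.≟ 8) →-dec
    (admissible? (lookup (a ∷ b ∷ c ∷ d ∷ [])) →-dec
     sortsToConfiguration? (map (8 +_) (a ∷ b ∷ c ∷ d ∷ [])))) 9) 9) 9) 9)
  where
  admissible? : ∀ a → Dec (Admissible a)
  admissible? a = all? λ i → all? λ j →
    ¬? (i ≟ j) →-dec ((a i + a i) + ((a j + a j) + (a j + a j)) ℕ.≤? 16)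

  sortsToConfiguration? : ∀ xs → Dec (SortsToConfiguration xs)
  sortsToConfiguration? xs = ≡-dec ℕ._≟_ (sort xs) _ ⊎-dec ≡-dec ℕ._≟_ (sort xs) _

-- The half of `v` is `m ∸ e`, the number of edges by which the color falls short of a perfect
-- matching on `m + m` vertices. The bound on it makes the search finite.
halve : ∀ m v e → v + (e + e) ≡ m + m → Σ[ a ∈ ℕ ] a ℕ.< ℕ.suc m × v ≡ a + a × v + e ≡ m + a
halve m v e eq = a , s≤s (ℕ.m∸n≤m m e) , v≡a+a , v+e≡m+a
  where
  e≤m : e ≤ m
  e≤m = ℕ.≮⇒≥ λ m<e → ℕ.<⇒≱ (ℕ.+-mono-< m<e m<e) (subst (e + e ≤_) eq (ℕ.m≤n+m (e + e) v))
  a = m ∸ e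
  a+e≡m : a + e ≡ m
  a+e≡m = ℕ.m∸n+n≡m e≤m
  v≡a+a : v ≡ a + a
  v≡a+a = ℕ.+-cancelʳ-≡ (e + e) v (a + a) (trans eq (trans (sym (cong₂ _+_ a+e≡m a+e≡m))
    (solve 2 (λ x y → (x :+ y) :+ (x :+ y) := (x :+ x) :+ (y :+ y)) refl a e)))
  v+e≡m+a : v + e ≡ m + a
  v+e≡m+a = begin
    v + e        ≡⟨ cong (_+ e) v≡a+a ⟩
    a + a + e    ≡⟨ ℕ.+-assoc a a e ⟩
    a + (a + e)  ≡⟨ cong (a +_) a+e≡m ⟩
    a + m        ≡⟨ ℕ.+-comm a m ⟩
    m + a        ∎
    where open ≡-Reasoning

-- v and e count the vertices and the edges of each color.
module _ (v e : Fin 4 → ℕ) (v+2e≡16 : ∀ i → v i + (e i + e i) ≡ 16) (∑v≡16 : sum v ≡ 16)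
         (bound : ∀ i j → i ≢ j → v i + (v j + v j) ≤ 16) where

  private
    a : Fin 4 → ℕ
    a i = proj₁ (halve 8 (v i) (e i) (v+2e≡16 i))

    a<9 : ∀ i → a i ℕ.< 9
    a<9 i = proj₁ (proj₂ (halve 8 (v i) (e i) (v+2e≡16 i)))

    v≡2a : ∀ i → v i ≡ a i + a i
    v≡2a i = proj₁ (proj₂ (proj₂ (halve 8 (v i) (e i) (v+2e≡16 i))))

    v+e≡8+a : ∀ i → v i + e i ≡ 8 + a i
    v+e≡8+a i = proj₂ (proj₂ (proj₂ (halve 8 (v i) (e i) (v+2e≡16 i))))

    ∑a≡8 : sum a ≡ 8
    ∑a≡8 = ℕ.*-cancelˡ-≡ (sum a) 8 2 (begin
      2 * sum a                 ≡⟨ cong (sum a +_) (ℕ.+-identityʳ (sum a)) ⟩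
      sum a + sum a             ≡⟨ ∑-distrib-+ a a ⟨
      ∑[ i < 4 ] (a i + a i)    ≡⟨ sum-cong-≗ v≡2a ⟨
      sum v                     ≡⟨ ∑v≡16 ⟩
      16                        ∎)
      where open ≡-Reasoning

    -- The search speaks of explicit quadruples, so `a` is replaced by its table, which agrees with
    -- it pointwise but not definitionally at a variable index.
    admissible : Admissible (lookup (tabulate a))
    admissible i j i≢j = subst (_≤ 16) (cong₂ (λ x y → x + (y + y)) (v≡ i) (v≡ j)) (bound i j i≢j)
      where
      v≡ : ∀ i → v i ≡ lookup (tabulate a) i + lookup (tabulate a) i
      v≡ i = trans (v≡2a i) (sym (cong₂ _+_ (lookup∘tabulate a i) (lookup∘tabulate a i)))

  sizes-configuration : SortsToConfiguration (map (λ i → v i + e i) (allFin 4))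
  sizes-configuration = subst SortsToConfiguration (sym (map-cong v+e≡8+a (allFin 4)))
    (admissible-configurations (a<9 0F) (a<9 1F) (a<9 2F) (a<9 3F) ∑a≡8 admissible)

configuration : (G : Graph 16) → Cubic G → (c : TotalColoring G 4) →
  HasConfiguration c (10 ∷ 10 ∷ 10 ∷ 10 ∷ []) ⊎ HasConfiguration c (11 ∷ 10 ∷ 10 ∷ 9 ∷ [])
configuration G cubic c =
  Sum.map (toConfiguration (10 ∷ 10 ∷ 10 ∷ 10 ∷ [])) (toConfiguration (11 ∷ 10 ∷ 10 ∷ 9 ∷ []))
    (sizes-configuration (vertices# G c) (edges# G c) (vertices#+2edges# G c regular)
      (∑-vertices# G c regular) (λ _ _ → vertices#-bound G c regular))
  where
  regular : ∀ v → ℕ.suc (degree G v) ≡ 4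
  regular v = cong ℕ.suc (cubic v)

  toConfiguration : ∀ ys → sort (map (λ i → vertices# G c i + edges# G c i) (allFin 4)) ≡ sort ys →
    HasConfiguration c ys
  toConfiguration ys eq = subst (_↭ ys) (sym (map-cong (length-colorClass G c) (allFin 4)))
    (sort-≡⇒↭ _ ys eq)

-- Being constant survives permutation, so all classes have size `m`. This rules out the balanced
-- configuration for non-equitable colorings.
equitable-const : ∀ {n k m ms} {G : Graph n} (c : TotalColoring G k) →
  All (_≡ m) ms → HasConfiguration c ms → Equitable c
equitable-const {m = m} c ms≡m σ i j = ℕ.≤-trans (ℕ.≤-reflexive (ℕ.m≡n⇒∣m-n∣≡0 size≡)) z≤n
  where
  sizes : ∀ i → length (colorClass c i) ≡ m
  sizes = All.tabulate⁻ (All.map⁻ (All-resp-↭ (↭-sym σ) ms≡m))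
  size≡ : length (colorClass c i) ≡ length (colorClass c j)
  size≡ = trans (sizes i) (sym (sizes j))

-- Certifying a coloring by a finite check.

-- A total coloring given by a matrix: the color of u is in position (u , u),
-- and that of the edge uv in positions (u , v) and (v , u).
module _ {n k : ℕ} (G : Graph n) (col : Fin n → Fin n → Fin k) where
  open Graph G using (adj; Adj)

  -- Phrased with vertices instead of edges, so that it is decided by search over `Fin n`. Only
  -- diagonal entries and entries at adjacent pairs are constrained.
  ProperMatrix : Set
  ProperMatrix = ∀ u v → Adj u v →
    col u v ≡ col v u × col u u ≢ col v v × col u u ≢ col u v ×
    (∀ w → Adj u w → v ≢ w → col u v ≢ col u w)

  properMatrix? : Dec ProperMatrix
  properMatrix? = all? λ u → all? λ v → T? (adj u v) →-dec
    ((col u v ≟ col v u) ×-dec (¬? (col u u ≟ col v v) ×-dec (¬? (col u u ≟ col u v) ×-dec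
      all? (λ w → T? (adj u w) →-dec (¬? (v ≟ w) →-dec ¬? (col u v ≟ col u w))))))

  module _ (proper : ProperMatrix) where

    matrixColor : Element G → Fin k
    matrixColor (inj₁ v)                = col v v
    matrixColor (inj₂ (edge lo hi _ _)) = col lo hi

    matrixColor-Joins : ∀ {e u v} → Joins G e u v → matrixColor (inj₂ e) ≡ col u v
    matrixColor-Joins (up refl refl)                  = refl
    matrixColor-Joins {edge lo hi _ a} (down refl refl) = proj₁ (proper lo hi a)

    other-end : ∀ {v e} → Incident G v e → Σ[ w ∈ Fin n ] Joins G e v w
    other-end (at-lo p) = _ , up p refl
    other-end (at-hi p) = _ , down p refl

    totalColoring : TotalColoring G k
    totalColoring = record
      { color         = matrixColor
      ; vertex-vertex = λ u v a → proj₁ (proj₂ (proper u v a))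
      ; edge-edge     = λ e f e≢f v p q → edges-proper e f e≢f v (other-end p) (other-end q)
      ; vertex-edge   = λ v e p → vertex-edge-proper v e (other-end p)
      }
      where
      edges-proper : ∀ e f → e ≢ f → ∀ u → Σ[ v ∈ Fin n ] Joins G e u v → Σ[ w ∈ Fin n ] Joins G f u w →
        matrixColor (inj₂ e) ≢ matrixColor (inj₂ f)
      edges-proper e f e≢f u (v , j) (w , j′) eq =
        proj₂ (proj₂ (proj₂ (proper u v (Joins-Adj G j)))) w (Joins-Adj G j′)
          (λ { refl → e≢f (Joins-injective G j j′) })
          (trans (sym (matrixColor-Joins j)) (trans eq (matrixColor-Joins j′)))

      vertex-edge-proper : ∀ u e → Σ[ v ∈ Fin n ] Joins G e u v → matrixColor (inj₁ u) ≢ matrixColor (inj₂ e)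
      vertex-edge-proper u e (v , j) eq =
        proj₁ (proj₂ (proj₂ (proper u v (Joins-Adj G j)))) (trans eq (matrixColor-Joins j))

-- The two colorings of `H₁₆`.

-- Row v of a table lists, for each color i, the vertex joined to v by the
-- edge of color i, or v itself if v has color i.
Table : Set
Table = Vec (Vec ℕ 4) 16

-- A number absent from the row gets the last index. This happens only at distinct non-adjacent
-- pairs, whose entries `ProperMatrix` never reads.
indexOf : ∀ {k} → Vec ℕ (ℕ.suc k) → ℕ → Fin (ℕ.suc k)
indexOf         (_ ∷ [])     m = zero
indexOf {ℕ.suc _} (x ∷ y ∷ ys) m = if x ≡ᵇ m then zero else suc (indexOf (y ∷ ys) m)

colorMatrix : Table → Fin 16 → Fin 16 → Fin 4
colorMatrix t u v = indexOf (lookup t u) (toℕ v)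

-- Each color is on 4 vertices and 6 edges.
equitableTable : Table
equitableTable =
  ( 0 ∷  8 ∷  2 ∷ 15 ∷ []) ∷ (12 ∷  7 ∷  9 ∷  1 ∷ []) ∷
  (13 ∷  2 ∷  0 ∷  4 ∷ []) ∷ ( 7 ∷  5 ∷ 15 ∷  3 ∷ []) ∷
  (10 ∷ 14 ∷  4 ∷  2 ∷ []) ∷ ( 5 ∷  3 ∷ 11 ∷  8 ∷ []) ∷
  ( 6 ∷ 12 ∷ 13 ∷  7 ∷ []) ∷ ( 3 ∷  1 ∷  7 ∷  6 ∷ []) ∷
  (15 ∷  0 ∷  8 ∷  5 ∷ []) ∷ ( 9 ∷ 13 ∷  1 ∷ 11 ∷ []) ∷
  ( 4 ∷ 10 ∷ 14 ∷ 12 ∷ []) ∷ (14 ∷ 11 ∷  5 ∷  9 ∷ []) ∷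
  ( 1 ∷  6 ∷ 12 ∷ 10 ∷ []) ∷ ( 2 ∷  9 ∷  6 ∷ 13 ∷ []) ∷
  (11 ∷  4 ∷ 10 ∷ 14 ∷ []) ∷ ( 8 ∷ 15 ∷  3 ∷  0 ∷ []) ∷ []

-- The colors, in order, are on 6, 4, 4, 2 vertices and on 5, 6, 6, 7 edges.
nonEquitableTable : Table
nonEquitableTable =
  (15 ∷  0 ∷  2 ∷  8 ∷ []) ∷ ( 7 ∷  9 ∷  1 ∷ 12 ∷ []) ∷
  ( 2 ∷  4 ∷  0 ∷ 13 ∷ []) ∷ ( 3 ∷  5 ∷  7 ∷ 15 ∷ []) ∷
  (10 ∷  2 ∷  4 ∷ 14 ∷ []) ∷ (11 ∷  3 ∷  8 ∷  5 ∷ []) ∷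
  (13 ∷ 12 ∷  6 ∷  7 ∷ []) ∷ ( 1 ∷  7 ∷  3 ∷  6 ∷ []) ∷
  ( 8 ∷ 15 ∷  5 ∷  0 ∷ []) ∷ ( 9 ∷  1 ∷ 13 ∷ 11 ∷ []) ∷
  ( 4 ∷ 14 ∷ 12 ∷ 10 ∷ []) ∷ ( 5 ∷ 11 ∷ 14 ∷  9 ∷ []) ∷
  (12 ∷  6 ∷ 10 ∷  1 ∷ []) ∷ ( 6 ∷ 13 ∷  9 ∷  2 ∷ []) ∷
  (14 ∷ 10 ∷ 11 ∷  4 ∷ []) ∷ ( 0 ∷  8 ∷ 15 ∷  3 ∷ []) ∷ []

equitableTable-proper : ProperMatrix H₁₆ (colorMatrix equitableTable)
equitableTable-proper = from-yes (properMatrix? H₁₆ (colorMatrix equitableTable))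

equitableColoring : TotalColoring H₁₆ 4
equitableColoring = totalColoring H₁₆ (colorMatrix equitableTable) equitableTable-proper

nonEquitableTable-proper : ProperMatrix H₁₆ (colorMatrix nonEquitableTable)
nonEquitableTable-proper = from-yes (properMatrix? H₁₆ (colorMatrix nonEquitableTable))

nonEquitableColoring : TotalColoring H₁₆ 4
nonEquitableColoring = totalColoring H₁₆ (colorMatrix nonEquitableTable) nonEquitableTable-proper

equitableColoring-configuration : HasConfiguration equitableColoring (10 ∷ 10 ∷ 10 ∷ 10 ∷ [])
equitableColoring-configuration = ↭-reflexive refl

nonEquitableColoring-configuration : HasConfiguration nonEquitableColoring (11 ∷ 10 ∷ 10 ∷ 9 ∷ [])
nonEquitableColoring-configuration = ↭-reflexive refl

nonEquitableColoring-¬Equitable : ¬ Equitable nonEquitableColoring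
-- The first and last classes have sizes 11 and 9, which would give `2 ≤ 1`.
nonEquitableColoring-¬Equitable equitable with s≤s () ← equitable 0F 3F

-- Regularity and connectedness of `H₁₆`.

H₁₆-cubic : Cubic H₁₆
H₁₆-cubic = from-yes (all? λ v → degree H₁₆ v ℕ.≟ 3)

-- A breadth-first search tree of H₁₆ rooted at 0, of depth 4.
parent : Fin 16 → Fin 16
parent = lookup (# 0 ∷ # 9 ∷ # 0 ∷ # 15 ∷ # 2 ∷ # 8 ∷ # 13 ∷ # 3 ∷
                 # 0 ∷ # 13 ∷ # 4 ∷ # 5 ∷ # 10 ∷ # 2 ∷ # 4 ∷ # 0 ∷ [])

H₁₆-connected : Connected H₁₆
-- Climb from `u` to the root, then follow the climb from `v` backwards.
H₁₆-connected u v = toRoot u ◅◅ reverse (λ {x} {y} → Adj-sym H₁₆ {x} {y}) (toRoot v)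
  where
  Adj = Graph.Adj H₁₆

  -- The root is its own parent, so four steps lead to it from every vertex, whatever its depth.
  step : ∀ v → v ≡ parent v ⊎ Adj v (parent v)
  step = from-yes (all? λ v → (v ≟ parent v) ⊎-dec T? (Graph.adj H₁₆ v (parent v)))

  ancestor : ℕ → Fin 16 → Fin 16
  ancestor ℕ.zero    v = v
  ancestor (ℕ.suc d) v = ancestor d (parent v)

  toAncestor : ∀ d v → Star Adj v (ancestor d v)
  toAncestor ℕ.zero    v = ε
  toAncestor (ℕ.suc d) v with step v
  ... | inj₁ eq = subst (λ w → Star Adj w (ancestor d (parent v))) (sym eq) (toAncestor d (parent v))
  ... | inj₂ a  = a ◅ toAncestor d (parent v)

  ancestor-root : ∀ v → ancestor 4 v ≡ 0F
  ancestor-root = from-yes (all? λ v → ancestor 4 v ≟ 0F)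

  toRoot : ∀ v → Star Adj v 0F
  toRoot v = subst (Star Adj v) (ancestor-root v) (toAncestor 4 v)

theorem5p3 : ((G : Graph 16) → Cubic G → (c : TotalColoring G 4) →
    HasConfiguration c (10 ∷ 10 ∷ 10 ∷ 10 ∷ []) ⊎
    HasConfiguration c (11 ∷ 10 ∷ 10 ∷ 9 ∷ []))
    × (Connected H₁₆ × Cubic H₁₆
    × Σ (TotalColoring H₁₆ 4) (λ c → HasConfiguration c (10 ∷ 10 ∷ 10 ∷ 10 ∷ []))
    × Σ (TotalColoring H₁₆ 4) (λ c → HasConfiguration c (11 ∷ 10 ∷ 10 ∷ 9 ∷ [])))
    × ((xs : List ℕ) →
    Σ (Graph 16) (λ G → Cubic G × Σ (TotalColoring G 4) (λ c →
    ¬ Equitable c × HasConfiguration c xs))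
    ⇔ (xs ↭ (11 ∷ 10 ∷ 10 ∷ 9 ∷ [])))
theorem5p3 =
    configuration
  , ( H₁₆-connected
    , H₁₆-cubic
    , (equitableColoring , equitableColoring-configuration)
    , (nonEquitableColoring , nonEquitableColoring-configuration) )
  , λ xs → mk⇔ unique (attained xs)
  where
  unique : ∀ {xs} → Σ (Graph 16) (λ G → Cubic G × Σ (TotalColoring G 4) (λ c →
    ¬ Equitable c × HasConfiguration c xs)) → xs ↭ (11 ∷ 10 ∷ 10 ∷ 9 ∷ [])
  unique (G , cubic , c , ¬equitable , σ) = Sum.[
      (λ τ → contradiction (equitable-const c (refl ∷ refl ∷ refl ∷ refl ∷ []) τ) ¬equitable)
    , ↭-trans (↭-sym σ)
    ]′ (configuration G cubic c)

  attained : ∀ xs → xs ↭ (11 ∷ 10 ∷ 10 ∷ 9 ∷ []) → Σ (Graph 16) (λ G → Cubic G ×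
    Σ (TotalColoring G 4) (λ c → ¬ Equitable c × HasConfiguration c xs))
  -- One coloring serves every ordering of the multiset.
  attained xs σ = H₁₆ , H₁₆-cubic , nonEquitableColoring , nonEquitableColoring-¬Equitable ,
    ↭-trans nonEquitableColoring-configuration (↭-sym σ)
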